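{- Let $N$ be an odd positive integer with $\sigma^*(\sigma^*(N))=2N$ and $N\neq 9,165$, and write $\sigma^*(N)=2^{f_1}q^{f_2}$ with $q$ an odd prime and $f_1,f_2\ge1$. Then $q\neq 5$.
   Context: $\sigma^*(n)$ is the sum of the unitary divisors of $n$, i.e. divisors $d$ of $n$ with $\gcd(d,n/d)=1$. For odd $N$ with $\sigma^*(\sigma^*(N))=2N$, $\sigma^*(N)$ is always of the form $2^{f_1}q^{f_2}$ with $q$ an odd prime. -}

module Defs where

open import Data.Nat using (ℕ; zero; suc; _+_; _*_)
open import Data.Nat.Divisibility using (_∣_; _∣?_)
open import Data.Nat.GCD using (gcd)
open import Data.Nat.DivMod using (_/_)
open import Data.Nat.Properties using (_≟_)
open import Data.List using (List; filter; upTo; map)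
open import Data.Nat.ListAction using (sum)
open import Data.Product using (_×_)
open import Relation.Binary.PropositionalEquality using (_≡_)
open import Relation.Nullary.Decidable using (Dec; _×-dec_)

-- The candidate divisor suc k (k ranging over 0 .. n-1, i.e. d over 1 .. n)
-- is a unitary divisor of n: d ∣ n and gcd(d, n/d) = 1.
IsUnitaryDivisor : ℕ → ℕ → Set
IsUnitaryDivisor n k = suc k ∣ n × gcd (suc k) (n / suc k) ≡ 1

isUnitaryDivisor? : (n k : ℕ) → Dec (IsUnitaryDivisor n k)
isUnitaryDivisor? n k = (suc k ∣? n) ×-dec (gcd (suc k) (n / suc k) ≟ 1)

σ* : ℕ → ℕ
σ* n = sum (map suc (filter (isUnitaryDivisor? n) (upTo n)))

-- Write σ*(N) = 2ᵃ5ᵇ, so that 2N = (2ᵃ + 1)(5ᵇ + 1) and σ*(N)/N = 2 / ((1 + 2⁻ᵃ)(1 + 5⁻ᵇ)), which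
-- is close to 2 unless a or b is small.  Every full prime power P of N has P + 1 = 2ˣ5ʸ, and
-- x + y is odd if 3 ∤ P.  These P are so sparse that the part of N prime to 3 and 7 has
-- σ*(n)/n ≤ 15/13, while the parts at 3 and 7 contribute at most 4/3 · 8/7 (10/9 · 8/7 if 9 ∣ N).
-- This excludes a ≥ 4 with b ≥ 2, and also a ≥ 3 with 9 ∣ N, which is the case for a = 3 and for
-- b = 1 with a odd.  For b = 1 and even a ≥ 4 there is no part at 7, because 7 ∤ 2ᵃ + 1, and the
-- bound suffices again.  If a = 2, then 5ᵉ + 1 divides 4 · 5ᵇ for the part 5ᵉ ≥ 5 of N, which is
-- impossible.  If a = 1, then N is a power of 3, and N = 9 follows.
module Submission where

open import Defs
open import Data.Empty using (⊥; ⊥-elim)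
open import Data.List using (List; []; _∷_; _++_; filter; upTo; map; cartesianProductWith)
open import Data.List.Membership.Propositional using (_∈_)
open import Data.List.Membership.Propositional.Properties
  using (∈-map⁺; ∈-map⁻; ∈-filter⁺; ∈-filter⁻; ∈-upTo⁺;
         ∈-cartesianProductWith⁺; ∈-cartesianProductWith⁻)
open import Data.List.Membership.Propositional.Properties.WithK using (unique∧set⇒bag)
open import Data.List.Relation.Binary.BagAndSetEquality using (∼bag⇒↭)
open import Data.List.Relation.Binary.Disjoint.Propositional using (Disjoint)
open import Data.List.Relation.Unary.All as All using ([]; _∷_)
open import Data.List.Relation.Unary.AllPairs using ([]; _∷_)
open import Data.List.Relation.Unary.Any using (here; there)
open import Data.List.Relation.Unary.Unique.Propositional using (Unique)
import Data.List.Relation.Unary.Unique.Propositional.Properties as Uniqueₚ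
open import Data.Nat
open import Data.Nat.Coprimality as Coprimality
  using (Coprime; coprime-divisor; coprime-/gcd; coprime⇒gcd≡1; gcd≡1⇒coprime)
open import Data.Nat.DivMod using (_/_; m*n/n≡m; m*[n/m]≡n)
open import Data.Nat.Divisibility
open import Data.Nat.GCD using (gcd; gcd[m,n]∣m; gcd[m,n]∣n; gcd[m,n]≢0)
open import Data.Nat.ListAction using (sum; product)
open import Data.Nat.ListAction.Properties using (sum-++; sum-↭)
open import Data.Nat.Primality
  using (Prime; prime?; euclidsLemma; prime⇒irreducible; prime⇒nonTrivial; prime⇒nonZero)
open import Data.Nat.Primality.Factorisation using (factorise)
open import Data.Nat.Properties
open import Data.Nat.Tactic.RingSolver using (solve-∀)
open import Data.Product using (∃; ∃₂; ∃-syntax; _×_; _,_; proj₁; proj₂)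
open import Data.Sum as Sum using (_⊎_; inj₁; inj₂; assocʳ)
open import Function using (_∘_; mk⇔; it)
open import Relation.Binary.PropositionalEquality
open import Relation.Nullary
open import Relation.Nullary.Decidable using (map′; _×-dec_)
open import Data.List.Membership.DecPropositional _≟_ using (_∈?_)

-- Coprimality and unitary divisors

coprime-* : ∀ {a b c} → Coprime a b → Coprime a c → Coprime a (b * c)
coprime-* a⊥b a⊥c (d∣a , d∣bc) =
  a⊥c (d∣a , coprime-divisor (λ (x∣d , x∣b) → a⊥b (∣-trans x∣d d∣a , x∣b)) d∣bc)

coprime-∣ : ∀ {a b c d} → a ∣ c → b ∣ d → Coprime c d → Coprime a b
coprime-∣ a∣c b∣d c⊥d (x∣a , x∣b) = c⊥d (∣-trans x∣a a∣c , ∣-trans x∣b b∣d)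

infix 4 _∥_

_∥_ : ℕ → ℕ → Set
d ∥ n = ∃[ e ] n ≡ d * e × Coprime d e

∥⇒∣ : ∀ {d n} → d ∥ n → d ∣ n
∥⇒∣ {d} (e , n≡de , _) = divides e (trans n≡de (*-comm d e))

∥-trans : ∀ {c d n} → c ∥ d → d ∥ n → c ∥ n
∥-trans {c} (e , refl , c⊥e) (f , refl , ce⊥f) =
  e * f , *-assoc c e f , coprime-* c⊥e (coprime-∣ (m∣m*n e) ∣-refl ce⊥f)

1∥ : ∀ n → 1 ∥ n
1∥ n = n , sym (*-identityˡ n) , Coprimality.1-coprimeTo n

n∥n : ∀ n → n ∥ n
n∥n n = 1 , sym (*-identityʳ n) , Coprimality.sym (Coprimality.1-coprimeTo n)

gcd-split : ∀ m n → .{{NonZero n}} →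
            ∃ λ g → ∃₂ λ a b → m ≡ g * a × n ≡ g * b × Coprime a b
gcd-split m n =
  gcd m n , m / gcd m n , n / gcd m n ,
  sym (m*[n/m]≡n (gcd[m,n]∣m m n)) , sym (m*[n/m]≡n (gcd[m,n]∣n m n)) , coprime-/gcd m n
  where instance _ = ≢-nonZero (gcd[m,n]≢0 m n (inj₂ (≢-nonZero⁻¹ n)))

∥-* : ∀ {a b m n} → Coprime m n → a ∥ m → b ∥ n → a * b ∥ m * n
∥-* {a} {b} m⊥n (e , refl , a⊥e) (f , refl , b⊥f) =
  e * f , [m*n]*[o*p]≡[m*o]*[n*p] a e b f ,
  Coprimality.sym (coprime-*
    (Coprimality.sym (coprime-* a⊥e (coprime-∣ (m∣m*n e) (n∣m*n b) m⊥n)))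
    (Coprimality.sym (coprime-* (Coprimality.sym (coprime-∣ (n∣m*n a) (m∣m*n f) m⊥n)) b⊥f)))

-- Let g = gcd(d, m), d = ga and m = gb. Then a is coprime to b, so a divides n, say n = ca. The
-- cofactor `e` is cb, and `d⊥e` yields both that g is coprime to b and that a is coprime to c.
∥*⇒ : ∀ {d m n} → .{{NonZero (m * n)}} → Coprime m n → d ∥ m * n →
      ∃₂ λ a b → a ∥ m × b ∥ n × d ≡ a * b
∥*⇒ {d} {m} {n} m⊥n (e , mn≡de , d⊥e) with gcd-split d m {{m*n≢0⇒m≢0 m}}
... | g , a , b , refl , refl , a⊥b with coprime-divisor a⊥b a∣bn
  where
  a∣bn : a ∣ b * n
  a∣bn = *-cancelˡ-∣ g {{m*n≢0⇒m≢0 g {{m*n≢0⇒m≢0 (g * b)}}}}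
    (divides e (trans (sym (*-assoc g b n)) (trans mn≡de (*-comm (g * a) e))))
... | divides c refl = g , a , (b , refl , coprime-∣ (m∣m*n a) (divides c e≡cb) d⊥e) ,
                       (c , *-comm c a , coprime-∣ (n∣m*n g) (divides b (trans e≡cb (*-comm c b))) d⊥e) ,
                       refl
  where
  rearrange : ∀ g a b c → g * b * (c * a) ≡ g * a * (c * b)
  rearrange = solve-∀
  e≡cb : e ≡ c * b
  e≡cb = *-cancelˡ-≡ e (c * b) (g * a) {{ga≢0}} (trans (sym mn≡de) (rearrange g a b c))
    where
    ga≢0 : NonZero (g * a)
    ga≢0 = m*n≢0⇒m≢0 (g * a) {{subst NonZero mn≡de
      (m*n≢0 (g * b) (c * a) {{m*n≢0⇒m≢0 (g * b)}} {{m*n≢0⇒n≢0 (g * b)}})}}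

-- Sums over unitary divisors and the multiplicativity of σ*

unitaryDivisors : ℕ → List ℕ
unitaryDivisors n = map suc (filter (isUnitaryDivisor? n) (upTo n))

unitaryDivisors-unique : ∀ n → Unique (unitaryDivisors n)
unitaryDivisors-unique n =
  Uniqueₚ.map⁺ suc-injective (Uniqueₚ.filter⁺ (isUnitaryDivisor? n) (Uniqueₚ.upTo⁺ n))

∈-unitaryDivisors⁻ : ∀ {n d} → d ∈ unitaryDivisors n → d ∥ n
∈-unitaryDivisors⁻ {n} d∈ with ∈-map⁻ suc d∈
... | k , k∈ , refl with ∈-filter⁻ (isUnitaryDivisor? n) {xs = upTo n} k∈
... | _ , d∣n , gcd≡1 = n / suc k , sym (m*[n/m]≡n d∣n) , gcd≡1⇒coprime gcd≡1

∈-unitaryDivisors⁺ : ∀ {n d} → .{{NonZero n}} → d ∥ n → d ∈ unitaryDivisors n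
∈-unitaryDivisors⁺ {n} {zero} (e , n≡0 , _) = contradiction n≡0 (≢-nonZero⁻¹ n)
∈-unitaryDivisors⁺ {n} {suc k} d∥n@(e , n≡de , d⊥e) =
  ∈-map⁺ suc (∈-filter⁺ (isUnitaryDivisor? n) (∈-upTo⁺ (∣⇒≤ (∥⇒∣ d∥n)))
    (∥⇒∣ d∥n , trans (cong (gcd (suc k)) n/d≡e) (coprime⇒gcd≡1 d⊥e)))
  where
  n/d≡e : n / suc k ≡ e
  n/d≡e = trans (cong (_/ suc k) (trans n≡de (*-comm (suc k) e))) (m*n/n≡m e (suc k))

-- Two duplicate-free lists with the same elements are permutations of each other. This lets `σ*` be
-- computed from any convenient list of the unitary divisors.
σ*-unique : ∀ n {xs} → .{{NonZero n}} → Unique xs →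
            (∀ {d} → d ∈ xs → d ∥ n) → (∀ {d} → d ∥ n → d ∈ xs) → σ* n ≡ sum xs
σ*-unique n xs! sound complete = sum-↭ (∼bag⇒↭ (unique∧set⇒bag (unitaryDivisors-unique n) xs!
  (mk⇔ (complete ∘ ∈-unitaryDivisors⁻) (∈-unitaryDivisors⁺ ∘ sound))))

sum-map-* : ∀ k xs → sum (map (k *_) xs) ≡ k * sum xs
sum-map-* k [] = sym (*-zeroʳ k)
sum-map-* k (x ∷ xs) = trans (cong (k * x +_) (sum-map-* k xs)) (sym (*-distribˡ-+ k x (sum xs)))

sum-cartesianProductWith-* : ∀ xs ys → sum (cartesianProductWith _*_ xs ys) ≡ sum xs * sum ys
sum-cartesianProductWith-* [] ys = refl
sum-cartesianProductWith-* (x ∷ xs) ys = begin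
  sum (map (x *_) ys ++ cartesianProductWith _*_ xs ys) ≡⟨ sum-++ (map (x *_) ys) _ ⟩
  sum (map (x *_) ys) + sum (cartesianProductWith _*_ xs ys)
    ≡⟨ cong₂ _+_ (sum-map-* x ys) (sum-cartesianProductWith-* xs ys) ⟩
  x * sum ys + sum xs * sum ys ≡⟨ *-distribʳ-+ (sum ys) x (sum xs) ⟨
  (x + sum xs) * sum ys ∎
  where open ≡-Reasoning

-- Since `a` is coprime to `d`, and `b` to `c`, each of `a` and `b` divides the other. This keeps
-- the products of divisors of `m` and of `n` distinct.
*-cancel-∣ : ∀ {a b c d m n} → .{{NonZero (m * n)}} → Coprime m n →
             a ∣ m → b ∣ m → c ∣ n → d ∣ n → a * c ≡ b * d → a ≡ b
*-cancel-∣ {a} {b} {c} {d} m⊥n a∣m b∣m c∣n d∣n ac≡bd = ∣-antisym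
  (coprime-divisor (coprime-∣ a∣m d∣n m⊥n) (subst (a ∣_) (trans ac≡bd (*-comm b d)) (m∣m*n c)))
  (coprime-divisor (coprime-∣ b∣m c∣n m⊥n) (subst (b ∣_) (trans (sym ac≡bd) (*-comm a c)) (m∣m*n d)))

cartesianProductWith-*-unique : ∀ {m n xs ys} → .{{NonZero (m * n)}} → Coprime m n →
  (∀ {x} → x ∈ xs → x ∣ m) → (∀ {y} → y ∈ ys → y ∣ n) →
  Unique xs → Unique ys → Unique (cartesianProductWith _*_ xs ys)
cartesianProductWith-*-unique {xs = []} m⊥n xs∣m ys∣n [] ys! = []
cartesianProductWith-*-unique {m} {n} {x ∷ xs} {ys} m⊥n xs∣m ys∣n (x∉xs ∷ xs!) ys! =
  Uniqueₚ.++⁺ (Uniqueₚ.map⁺ (*-cancelˡ-≡ _ _ x) ys!)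
    (cartesianProductWith-*-unique {m} {n} m⊥n (xs∣m ∘ there) ys∣n xs! ys!) disjoint
  where
  instance
    x≢0 : NonZero x
    x≢0 = ≢-nonZero λ { refl → ≢-nonZero⁻¹ m {{m*n≢0⇒m≢0 m}} (0∣⇒≡0 (xs∣m (here refl))) }
  disjoint : Disjoint (map (x *_) ys) (cartesianProductWith _*_ xs ys)
  disjoint (v∈₁ , v∈₂) with ∈-map⁻ (x *_) v∈₁ | ∈-cartesianProductWith⁻ _*_ xs ys v∈₂
  ... | c , c∈ , refl | b , d , b∈ , d∈ , xc≡bd =
    All.lookup x∉xs b∈
      (*-cancel-∣ {m = m} {n} m⊥n (xs∣m (here refl)) (xs∣m (there b∈)) (ys∣n c∈) (ys∣n d∈) xc≡bd)

σ*-* : ∀ {m n} → .{{NonZero (m * n)}} → Coprime m n → σ* (m * n) ≡ σ* m * σ* n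
σ*-* {m} {n} m⊥n = trans
  (σ*-unique (m * n) unique sound complete)
  (sum-cartesianProductWith-* (unitaryDivisors m) (unitaryDivisors n))
  where
  products = cartesianProductWith _*_ (unitaryDivisors m) (unitaryDivisors n)
  instance
    m≢0 : NonZero m
    m≢0 = m*n≢0⇒m≢0 m
    n≢0 : NonZero n
    n≢0 = m*n≢0⇒n≢0 m
  unique : Unique products
  unique = cartesianProductWith-*-unique {m} {n} m⊥n
    (∥⇒∣ ∘ ∈-unitaryDivisors⁻) (∥⇒∣ ∘ ∈-unitaryDivisors⁻)
    (unitaryDivisors-unique m) (unitaryDivisors-unique n)
  sound : ∀ {d} → d ∈ products → d ∥ m * n
  sound d∈ with ∈-cartesianProductWith⁻ _*_ (unitaryDivisors m) (unitaryDivisors n) d∈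
  ... | _ , _ , a∈ , b∈ , refl = ∥-* m⊥n (∈-unitaryDivisors⁻ a∈) (∈-unitaryDivisors⁻ b∈)
  complete : ∀ {d} → d ∥ m * n → d ∈ products
  complete d∥mn with ∥*⇒ m⊥n d∥mn
  ... | _ , _ , a∥m , b∥n , refl =
    ∈-cartesianProductWith⁺ _*_ (∈-unitaryDivisors⁺ a∥m) (∈-unitaryDivisors⁺ b∥n)

-- Prime powers and p-parts

prime⇒≢1 : ∀ {p} → Prime p → p ≢ 1
prime⇒≢1 p-prime refl with () ← prime⇒nonTrivial p-prime

∤⇒coprime : ∀ {p n} → Prime p → p ∤ n → Coprime p n
∤⇒coprime p-prime p∤n (d∣p , d∣n) with prime⇒irreducible p-prime d∣p
... | inj₁ d≡1 = d≡1
... | inj₂ refl = contradiction d∣n p∤n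

coprime-^ˡ : ∀ {m n} e → Coprime m n → Coprime (m ^ e) n
coprime-^ˡ {n = n} zero m⊥n = Coprimality.1-coprimeTo n
coprime-^ˡ (suc e) m⊥n = Coprimality.sym
  (coprime-* (Coprimality.sym m⊥n) (Coprimality.sym (coprime-^ˡ e m⊥n)))

∣^⇒∣ : ∀ {p d} e → Prime p → d ∣ p ^ e → d ≢ 1 → p ∣ d
∣^⇒∣ {p} {d} e p-prime d∣pᵉ d≢1 with p ∣? d
... | yes p∣d = p∣d
... | no p∤d = contradiction (coprime-^ˡ e (∤⇒coprime p-prime p∤d) (d∣pᵉ , ∣-refl)) d≢1

σ*-prime^ : ∀ {p} e → Prime p → σ* (p ^ suc e) ≡ suc (p ^ suc e)
σ*-prime^ {p} e p-prime = trans
  (σ*-unique n {{n≢0}} ((1≢n ∷ []) ∷ [] ∷ []) sound complete)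
  (cong suc (+-identityʳ n))
  where
  n = p ^ suc e
  n≢0 : NonZero n
  n≢0 = m^n≢0 p (suc e) {{prime⇒nonZero p-prime}}
  1≢n : 1 ≢ n
  1≢n 1≡n = prime⇒≢1 p-prime (m*n≡1⇒m≡1 p (p ^ e) (sym 1≡n))
  sound : ∀ {d} → d ∈ 1 ∷ n ∷ [] → d ∥ n
  sound (here refl) = 1∥ n
  sound (there (here refl)) = n∥n n
  complete : ∀ {d} → d ∥ n → d ∈ 1 ∷ n ∷ []
  complete {d} (f , n≡df , d⊥f) with d ≟ 1 | f ≟ 1
  ... | yes refl | _ = here refl
  ... | no _ | yes refl = there (here (sym (trans n≡df (*-identityʳ d))))
  -- Complementary divisors of a power of `p` that both differ from 1 share the factor `p`.
  ... | no d≢1 | no f≢1 = contradiction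
    (d⊥f (∣^⇒∣ (suc e) p-prime (divides f (trans n≡df (*-comm d f))) d≢1 ,
          ∣^⇒∣ (suc e) p-prime (divides d n≡df) f≢1))
    (prime⇒≢1 p-prime)

p-part : ∀ {p} → Prime p → ∀ n → .{{NonZero n}} → ∃₂ λ e m → n ≡ p ^ e * m × p ∤ m
p-part {p} p-prime n = go n n ≤-refl
  where
  -- The bound `b` drives the recursion; division by `p` makes `n` strictly smaller.
  go : ∀ b n → .{{NonZero n}} → n ≤ b → ∃₂ λ e m → n ≡ p ^ e * m × p ∤ m
  go b n n≤b with p ∣? n
  go b n n≤b | no p∤n = 0 , n , sym (*-identityˡ n) , p∤n
  go zero n n≤0 | yes _ = contradiction (n≤0⇒n≡0 n≤0) (≢-nonZero⁻¹ n)
  go (suc b) n n≤1+b | yes p∣n@(divides q refl)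
    with go b q {{m*n≢0⇒m≢0 q}}
           (≤-pred (<-≤-trans (quotient-< p∣n {{prime⇒nonTrivial p-prime}}) n≤1+b))
  ... | e , m , refl , p∤m = suc e , m , trans (*-comm _ p) (sym (*-assoc p (p ^ e) m)) , p∤m

∃-primeDivisor : ∀ n → 1 < n → ∃ λ p → Prime p × p ∣ n
∃-primeDivisor n 1<n with factorise n {{>-nonZero (<-trans z<s 1<n)}}
... | record { factors = [] ; isFactorisation = refl } = contradiction 1<n (<-irrefl refl)
... | record { factors = p ∷ ps ; isFactorisation = n≡ ; factorsPrime = p-prime ∷ _ } =
  p , p-prime , divides (product ps) (trans n≡ (*-comm p _))

-- Atoms, and bounds obtained by splitting them off

-- Bounds on quotients are kept cross-multiplied to stay in `ℕ`. Read as fractions, this multiplies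
-- s / u ≤ q / p by s′ / u′ ≤ q′ / p′.
*-ratio : ∀ p q p′ q′ s u s′ u′ → p * s ≤ q * u → p′ * s′ ≤ q′ * u′ →
          p * p′ * (s * s′) ≤ q * q′ * (u * u′)
*-ratio p q p′ q′ s u s′ u′ ps≤qu ps≤qu′ =
  subst₂ _≤_
    ([m*n]*[o*p]≡[m*o]*[n*p] p s p′ s′)
    ([m*n]*[o*p]≡[m*o]*[n*p] q u q′ u′)
    (*-mono-≤ ps≤qu ps≤qu′)

∥⇒σ*-* : ∀ {d n} → .{{NonZero n}} → ((e , _) : d ∥ n) → σ* n ≡ σ* d * σ* e
∥⇒σ*-* (e , refl , d⊥e) = σ*-* d⊥e

∥-complement : ∀ {d n} → ((e , _) : d ∥ n) → e ∥ n
∥-complement {d} (e , n≡de , d⊥e) = d , trans n≡de (*-comm d e) , Coprimality.sym d⊥e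

-- The condition on σ* forces P to be a prime power, so the atoms of n are the full prime
-- powers in its factorisation; unlike primality, being an atom needs no factorisation to state.
Atom : ℕ → ℕ → Set
Atom P n = P ∥ n × 1 < P × σ* P ≡ suc P

∥? : ∀ d n → .{{NonZero n}} → Dec (d ∥ n)
∥? d n = map′ ∈-unitaryDivisors⁻ ∈-unitaryDivisors⁺ (d ∈? unitaryDivisors n)

atom? : ∀ P n → .{{NonZero n}} → Dec (Atom P n)
atom? P n = ∥? P n ×-dec ((1 <? P) ×-dec (σ* P ≟ suc P))

-- The full power of any prime divisor of `n` serves.
∃-atom : ∀ n → 1 < n → ∃ λ P → Atom P n
∃-atom n 1<n with ∃-primeDivisor n 1<n
... | p , p-prime , p∣n with p-part p-prime n {{>-nonZero (<-trans z<s 1<n)}}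
... | zero , m , refl , p∤m = contradiction (subst (p ∣_) (*-identityˡ m) p∣n) p∤m
... | suc e , m , n≡ , p∤m =
  p ^ suc e , (m , n≡ , coprime-^ˡ (suc e) (∤⇒coprime p-prime p∤m)) ,
  ≤∧≢⇒< (m^n>0 p {{prime⇒nonZero p-prime}} (suc e))
    (λ 1≡ → prime⇒≢1 p-prime (m*n≡1⇒m≡1 p (p ^ e) (sym 1≡))) ,
  σ*-prime^ e p-prime

-- The set is applied to `suc P` because that is `σ* P`, the number which has to be of the form
-- 2ˣ5ʸ.
Atoms⊆ : (ℕ → Set) → ℕ → Set
Atoms⊆ S n = ∀ {P} → Atom P n → S (suc P)

-- From every n ≤ b one can split off the atoms P with suc P ∈ S; the part u split off
-- and its value s under σ* satisfy s / u ≤ q / p.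
record Strip (b : ℕ) (S : ℕ → Set) (p q : ℕ) : Set₁ where
  constructor mkStrip
  field
    split : ∀ n → .{{NonZero n}} → n ≤ b → (T : ℕ → Set) → Atoms⊆ (λ M → S M ⊎ T M) n →
      ∃ λ u → ∃₂ λ s r → n ≡ u * r × σ* n ≡ s * σ* r × p * s ≤ q * u × Atoms⊆ T r

open Strip

-- An atom of `n` is at most `n ≤ b`, so none has its successor in `S`, and u = 1 will do. This ends
-- the recursion along infinite sets.
strip-∅ : ∀ {b S p q} → p ≤ q → (∀ {M} → S M → suc b < M) → Strip b S p q
strip-∅ p≤q S>b .split n n≤b T atoms =
  1 , 1 , n , sym (*-identityˡ n) , sym (*-identityˡ (σ* n)) , *-monoˡ-≤ 1 p≤q , atoms′
  where
  atoms′ : Atoms⊆ T n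
  atoms′ {P} atom with atoms atom
  ... | inj₁ P∈S = contradiction (S>b P∈S) (≤⇒≯ (s≤s (≤-trans (∣⇒≤ (∥⇒∣ (proj₁ atom))) n≤b)))
  ... | inj₂ P∈T = P∈T

strip-single : ∀ {b} m → Strip b (_≡ suc m) m (suc m)
strip-single m .split n n≤b T atoms with atom? m n
... | yes (m∥n@(r , n≡mr , m⊥r) , 1<m , σ*m) =
  m , suc m , r , n≡mr , trans (∥⇒σ*-* m∥n) (cong (_* σ* r) σ*m) ,
  ≤-reflexive (*-comm m (suc m)) , atoms′
  where
  atoms′ : Atoms⊆ T r
  atoms′ (P∥r , 1<P , σ*P) with atoms (∥-trans P∥r (∥-complement m∥n) , 1<P , σ*P)
  -- The cofactor `r` is coprime to `m > 1`, so `m` does not occur a second time.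
  ... | inj₁ refl = contradiction (m⊥r (∣-refl , ∥⇒∣ P∥r)) (≢-sym (<⇒≢ 1<m))
  ... | inj₂ P∈T = P∈T
... | no ¬atom =
  1 , 1 , n , sym (*-identityˡ n) , sym (*-identityˡ (σ* n)) , *-monoˡ-≤ 1 (n≤1+n m) , atoms′
  where
  atoms′ : Atoms⊆ T n
  atoms′ atom with atoms atom
  ... | inj₁ refl = contradiction atom ¬atom
  ... | inj₂ P∈T = P∈T

strip-⊎ : ∀ {b S S′ p q p′ q′} → Strip b S p q → Strip b S′ p′ q′ →
          Strip b (λ M → S M ⊎ S′ M) (p * p′) (q * q′)
strip-⊎ {S′ = S′} {p} {q} {p′} {q′} strip strip′ .split n n≤b T atoms
  -- In the first pass the atoms in `S′` count as remainder, which is why `split` allows every `T`.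
  with strip .split n n≤b (λ M → S′ M ⊎ T M) (assocʳ ∘ atoms)
... | u , s , r , refl , σ*n≡ , ps≤qu , atoms₁
  with strip′ .split r {{m*n≢0⇒n≢0 u}} (≤-trans (m≤n*m r u {{m*n≢0⇒m≢0 u}}) n≤b) T atoms₁
... | u′ , s′ , r′ , refl , σ*r≡ , ps≤qu′ , atoms₂ =
  u * u′ , s * s′ , r′ , sym (*-assoc u u′ r′) ,
  trans σ*n≡ (trans (cong (s *_) σ*r≡) (sym (*-assoc s s′ _))) ,
  *-ratio p q p′ q′ s u s′ u′ ps≤qu ps≤qu′ , atoms₂

strip-weaken : ∀ {b S S′ p q p′ q′} → .{{NonZero q}} → p′ * q ≤ p * q′ → (∀ {M} → S′ M → S M) →
               Strip b S p q → Strip b S′ p′ q′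
strip-weaken {p = p} {q} {p′} {q′} p′q≤pq′ S′⊆S strip .split n n≤b T atoms
  with strip .split n n≤b T (Sum.map₁ S′⊆S ∘ atoms)
... | u , s , r , n≡ , σ*n≡ , ps≤qu , atoms′ =
  u , s , r , n≡ , σ*n≡ , *-cancelʳ-≤ _ _ q bound , atoms′
  where
  bound : p′ * s * q ≤ q′ * u * q
  bound = begin
    p′ * s * q   ≡⟨ swap p′ s q ⟩
    p′ * q * s   ≤⟨ *-monoˡ-≤ s p′q≤pq′ ⟩
    p * q′ * s   ≡⟨ swap p q′ s ⟩
    p * s * q′   ≤⟨ *-monoˡ-≤ q′ ps≤qu ⟩
    q * u * q′   ≡⟨ reverse q u q′ ⟩
    q′ * u * q   ∎
    where
    open ≤-Reasoning
    swap : ∀ x y z → x * y * z ≡ x * z * y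
    swap = solve-∀
    reverse : ∀ x y z → x * y * z ≡ z * y * x
    reverse = solve-∀

-- With the empty set for `T`, the remainder `r` has no atoms, hence is 1, and the part split off is
-- all of `n`.
strip⇒σ*≤ : ∀ {S p q} n → .{{NonZero n}} → Strip n S p q → Atoms⊆ S n → p * σ* n ≤ q * n
strip⇒σ*≤ {p = p} {q} n strip atoms with strip .split n ≤-refl (λ _ → ⊥) (inj₁ ∘ atoms)
... | u , s , r , n≡ur , σ*n≡ , bound , no-atoms with r≡1
  where
  r≡1 : r ≡ 1
  r≡1 with 1 <? r
  ... | yes 1<r = ⊥-elim (no-atoms (proj₂ (∃-atom r 1<r)))
  ... | no 1≮r = ≤-antisym (≮⇒≥ 1≮r) (>-nonZero⁻¹ r {{m*n≢0⇒n≢0 u {{subst NonZero n≡ur it}}}})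
... | refl = subst₂ (λ x y → p * x ≤ q * y)
  (sym (trans σ*n≡ (*-identityʳ s))) (sym (trans n≡ur (*-identityʳ u))) bound

-- Geometric families and their total contribution

Row : ℕ → ℕ → Set
Row m M = ∃[ i ] M ≡ 4 ^ i * m

-- The factors 4 and 25 preserve the parities of the exponents of 2 and 5, so a grid collects
-- numbers 2ˣ5ʸ with prescribed parities of x and y.
Grid : ℕ → ℕ → Set
Grid m M = ∃₂ λ i j → M ≡ 25 ^ j * (4 ^ i * m)

Row⇒≥ : ∀ {m M} → Row m M → m ≤ M
Row⇒≥ {m} (i , refl) = m≤n*m m (4 ^ i) {{m^n≢0 4 i}}

Grid⇒≥ : ∀ {m M} → Grid m M → m ≤ M
Grid⇒≥ {m} (i , j , refl) = ≤-trans (Row⇒≥ (i , refl)) (m≤n*m (4 ^ i * m) (25 ^ j) {{m^n≢0 25 j}})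

Row-split : ∀ {m m′ M} → m′ ≡ 4 * m → Row m M → M ≡ m ⊎ Row m′ M
Row-split {m} refl (zero , refl) = inj₁ (*-identityˡ m)
Row-split {m} refl (suc i , refl) = inj₂ (i , shift (4 ^ i) m)
  where
  shift : ∀ x y → 4 * x * y ≡ x * (4 * y)
  shift = solve-∀

Grid-split : ∀ {m m′ M} → m′ ≡ 25 * m → Grid m M → Row m M ⊎ Grid m′ M
Grid-split {m} refl (i , zero , refl) = inj₁ (i , *-identityˡ _)
Grid-split {m} refl (i , suc j , refl) = inj₂ (i , j , shift (25 ^ j) (4 ^ i) m)
  where
  shift : ∀ x y z → 25 * x * (y * z) ≡ x * (y * (25 * z))
  shift = solve-∀

-- For m = 2 + k the ratio is 3m / (3m - 4). It dominates ∏ 4ⁱm / (4ⁱm - 1) by telescoping,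
-- since m / (m - 1) * 12m / (12m - 4) ≤ 3m / (3m - 4).
strip-Row : ∀ {b} fuel k → suc b < fuel + (2 + k) → Strip b (Row (2 + k)) (3 * k + 2) (3 * (2 + k))
-- Without fuel the row starts above `suc b`. Each step along the row raises its start by at least
-- one, which pays for the fuel spent.
strip-Row zero k b<m = strip-∅
  (≤-trans (m≤m+n _ 4) (≤-reflexive (reassoc k))) (λ M∈ → <-≤-trans b<m (Row⇒≥ M∈))
  where
  reassoc : ∀ k → 3 * k + 2 + 4 ≡ 3 * (2 + k)
  reassoc = solve-∀
strip-Row {b} (suc fuel) k b<m =
  strip-weaken {q = (2 + k) * (3 * (2 + (4 * k + 6)))}
    (≤-trans (m≤m+n _ (12 * (2 + k))) (≤-reflexive (telescope k))) (Row-split (next k))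
    (strip-⊎ (strip-single (1 + k)) (strip-Row fuel (4 * k + 6) b<m′))
  where
  next : ∀ k → 2 + (4 * k + 6) ≡ 4 * (2 + k)
  next = solve-∀
  telescope : ∀ k → (3 * k + 2) * ((2 + k) * (3 * (2 + (4 * k + 6)))) + 12 * (2 + k)
                  ≡ (1 + k) * (3 * (4 * k + 6) + 2) * (3 * (2 + k))
  telescope = solve-∀
  b<m′ : suc b < fuel + (2 + (4 * k + 6))
  b<m′ = <-≤-trans b<m (≤-trans (≤-reflexive (sym (+-suc fuel (2 + k))))
    (+-monoʳ-≤ fuel (≤-trans (m≤m+n (3 + k) (3 * k + 5)) (≤-reflexive (grow k)))))
    where
    grow : ∀ k → 3 + k + (3 * k + 5) ≡ 2 + (4 * k + 6)
    grow = solve-∀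

-- Likewise with ratio 18m / (18m - 25), since 3m / (3m - 4) * 18m / (18m - 1) ≤ 18m / (18m - 25).
strip-Grid : ∀ {b} fuel k → suc b < fuel + (2 + k) →
             Strip b (Grid (2 + k)) (18 * k + 11) (18 * (2 + k))
strip-Grid zero k b<m = strip-∅
  (≤-trans (m≤m+n _ 25) (≤-reflexive (reassoc k))) (λ M∈ → <-≤-trans b<m (Grid⇒≥ M∈))
  where
  reassoc : ∀ k → 18 * k + 11 + 25 ≡ 18 * (2 + k)
  reassoc = solve-∀
strip-Grid {b} (suc fuel) k b<m =
  strip-weaken {q = 3 * (2 + k) * (18 * (2 + (25 * k + 48)))}
    (≤-trans (m≤m+n _ (1800 * (2 + k))) (≤-reflexive (telescope k))) (Grid-split (next k))
    (strip-⊎ (strip-Row (suc fuel) k b<m) (strip-Grid fuel (25 * k + 48) b<m′))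
  where
  next : ∀ k → 2 + (25 * k + 48) ≡ 25 * (2 + k)
  next = solve-∀
  telescope : ∀ k → (18 * k + 11) * (3 * (2 + k) * (18 * (2 + (25 * k + 48)))) + 1800 * (2 + k)
                  ≡ (3 * k + 2) * (18 * (25 * k + 48) + 11) * (18 * (2 + k))
  telescope = solve-∀
  b<m′ : suc b < fuel + (2 + (25 * k + 48))
  b<m′ = <-≤-trans b<m (≤-trans (≤-reflexive (sym (+-suc fuel (2 + k))))
    (+-monoʳ-≤ fuel (≤-trans (m≤m+n (3 + k) (24 * k + 47)) (≤-reflexive (grow k)))))
    where
    grow : ∀ k → 3 + k + (24 * k + 47) ≡ 2 + (25 * k + 48)
    grow = solve-∀

-- The even numbers 2ˣ5ʸ with x + y odd, except 2 = 1 + 1 and 8 = 7 + 1.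
Target : ℕ → Set
Target M = Row 32 M ⊎ Grid 50 M ⊎ Grid 20 M

-- The ratios for the starts 32, 50 and 20 are 96/92, 900/875 and 360/335; their product is just
-- below 15/13.
strip-Target : ∀ b → Strip b Target 13 15
strip-Target b = strip-weaken {q = 96 * (900 * 360)}
  (≤ᵇ⇒≤ (13 * (96 * (900 * 360))) (92 * (875 * 335) * 15) _) (λ M∈ → M∈)
  (strip-⊎ row (strip-⊎ grid₅₀ grid₂₀))
  where
  -- Fuel `b` suffices because every start is at least 2.
  big : ∀ k → suc b < b + (2 + k)
  big k = ≤-trans (≤-reflexive (+-comm 2 b)) (+-monoʳ-≤ b (m≤m+n 2 k))
  row : Strip b (Row 32) 92 96
  row = strip-Row b 30 (big 30)
  grid₅₀ : Strip b (Grid 50) 875 900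
  grid₅₀ = strip-Grid b 48 (big 48)
  grid₂₀ : Strip b (Grid 20) 335 360
  grid₂₀ = strip-Grid b 18 (big 18)


-- Numbers of the form 2ˣ5ʸ and their residues modulo 3

prime₂ : Prime 2
prime₂ = from-yes (prime? 2)

prime₃ : Prime 3
prime₃ = from-yes (prime? 3)

prime₅ : Prime 5
prime₅ = from-yes (prime? 5)

prime₇ : Prime 7
prime₇ = from-yes (prime? 7)

-- What remains of `d` without its powers of 2 and 5 is coprime to `2 ^ a * 5 ^ b` and divides it,
-- so it is 1.
smooth : ∀ {d} a b → d ∣ 2 ^ a * 5 ^ b → ∃₂ λ x y → d ≡ 2 ^ x * 5 ^ y
smooth {d} a b d∣ with p-part prime₂ d {{d≢0}}
  where
  d≢0 : NonZero d
  d≢0 = ≢-nonZero λ { refl → ≢-nonZero⁻¹ (2 ^ a * 5 ^ b)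
    {{m*n≢0 (2 ^ a) (5 ^ b) {{m^n≢0 2 a}} {{m^n≢0 5 b}}}} (0∣⇒≡0 d∣) }
... | x , m , refl , 2∤m with p-part prime₅ m {{≢-nonZero λ { refl → 2∤m (2 ∣0) }}}
... | y , m′ , refl , 5∤m′ =
  x , y , cong (2 ^ x *_) (trans (cong (5 ^ y *_) m′≡1) (*-identityʳ (5 ^ y)))
  where
  m′∣5ᵇ : m′ ∣ 5 ^ b
  m′∣5ᵇ = coprime-divisor (Coprimality.sym (coprime-^ˡ a (∤⇒coprime prime₂ (2∤m ∘ ∣n⇒∣m*n (5 ^ y)))))
    (∣-trans (n∣m*n (5 ^ y)) (∣-trans (n∣m*n (2 ^ x)) d∣))
  m′≡1 : m′ ≡ 1
  m′≡1 = Coprimality.sym (coprime-^ˡ b (∤⇒coprime prime₅ 5∤m′)) (∣-refl , m′∣5ᵇ)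

even-or-odd : ∀ n → ∃[ i ] (n ≡ 2 * i ⊎ n ≡ suc (2 * i))
even-or-odd zero = 0 , inj₁ refl
even-or-odd (suc n) with even-or-odd n
... | i , inj₁ refl = i , inj₂ refl
... | i , inj₂ refl = suc i , inj₁ (sym (*-suc 2 i))

*-≡1-mod3 : ∀ u v → suc (3 * u) * suc (3 * v) ≡ suc (3 * (u + v + 3 * (u * v)))
*-≡1-mod3 = solve-∀

^≡1-mod3 : ∀ c i → ∃[ u ] suc (3 * c) ^ i ≡ suc (3 * u)
^≡1-mod3 c zero = 0 , refl
^≡1-mod3 c (suc i) with ^≡1-mod3 c i
... | u , eq = c + u + 3 * (c * u) , trans (cong (suc (3 * c) *_) eq) (*-≡1-mod3 c u)

4^*25^≡1-mod3 : ∀ i j → ∃[ u ] 4 ^ i * 25 ^ j ≡ suc (3 * u)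
-- 4 = 1 + 3 · 1 and 25 = 1 + 3 · 8.
4^*25^≡1-mod3 i j with ^≡1-mod3 1 i | ^≡1-mod3 8 j
... | u , p | v , q = u + v + 3 * (u * v) , trans (cong₂ _*_ p q) (*-≡1-mod3 u v)

2∤⇒2∣suc : ∀ {n} → 2 ∤ n → 2 ∣ suc n
2∤⇒2∣suc {n} 2∤n with even-or-odd n
... | i , inj₁ refl = contradiction (m∣m*n i) 2∤n
... | i , inj₂ refl = divides (suc i) (cong (2 +_) (*-comm 2 i))

-- Modulo 3 one has 2ˣ5ʸ ≡ (-1)ˣ⁺ʸ, so x and y have opposite parity unless 3 ∣ P.
smooth⇒Target : ∀ {P} x y → suc P ≡ 2 ^ x * 5 ^ y →
                2 ∤ P → 3 ∤ P → P ≢ 1 → P ≢ 7 → Target (suc P)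
smooth⇒Target {P} x y M≡ 2∤P 3∤P P≢1 P≢7 with even-or-odd x | even-or-odd y
... | i , inj₁ refl | j , inj₁ refl = contradiction 3∣P 3∤P
  where
  3∣P : 3 ∣ P
  3∣P with 4^*25^≡1-mod3 i j
  ... | u , eq = divides u (trans (suc-injective
    (trans M≡ (trans (cong₂ _*_ (sym (^-*-assoc 2 2 i)) (sym (^-*-assoc 5 2 j))) eq))) (*-comm 3 u))
... | i , inj₂ refl | j , inj₂ refl = contradiction 3∣P 3∤P
  where
  rearrange : ∀ s t → 2 * s * (5 * t) ≡ 10 * (s * t)
  rearrange = solve-∀
  expand : ∀ u → 10 * suc (3 * u) ≡ suc (3 * (3 + 10 * u))
  expand = solve-∀
  3∣P : 3 ∣ P
  3∣P with 4^*25^≡1-mod3 i j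
  ... | u , eq = divides (3 + 10 * u) (trans (suc-injective (trans M≡
    (trans (rearrange (2 ^ (2 * i)) (5 ^ (2 * j)))
    (trans (cong (10 *_) (trans (cong₂ _*_ (sym (^-*-assoc 2 2 i)) (sym (^-*-assoc 5 2 j))) eq))
    (expand u))))) (*-comm 3 (3 + 10 * u)))
... | i , inj₂ refl | j , inj₁ refl = odd-even i j
  (trans M≡ (cong₂ (λ s t → 2 * s * t) (sym (^-*-assoc 2 2 i)) (sym (^-*-assoc 5 2 j))))
  where
  odd-even : ∀ i j → suc P ≡ 2 * 4 ^ i * 25 ^ j → Target (suc P)
  odd-even 0 0 M≡ = contradiction (suc-injective M≡) P≢1
  odd-even 1 0 M≡ = contradiction (suc-injective M≡) P≢7
  odd-even (suc (suc i)) 0 M≡ = inj₁ (i , trans M≡ (shift (4 ^ i)))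
    where
    shift : ∀ s → 2 * (4 * (4 * s)) * 1 ≡ s * 32
    shift = solve-∀
  odd-even i (suc j) M≡ = inj₂ (inj₁ (i , j , trans M≡ (shift (4 ^ i) (25 ^ j))))
    where
    shift : ∀ s t → 2 * s * (25 * t) ≡ t * (s * 50)
    shift = solve-∀
... | i , inj₁ refl | j , inj₂ refl = even-odd i
  (trans M≡ (cong₂ (λ s t → s * (5 * t)) (sym (^-*-assoc 2 2 i)) (sym (^-*-assoc 5 2 j))))
  where
  even-odd : ∀ i → suc P ≡ 4 ^ i * (5 * 25 ^ j) → Target (suc P)
  -- The exponent of 2 is 0, so `suc P` would be a power of 5 and hence odd, while `P` is odd too.
  even-odd 0 M≡ = contradiction
    (coprime-^ˡ (suc (2 * j)) (gcd≡1⇒coprime {5} {2} refl) (subst (2 ∣_) M≡5^ (2∤⇒2∣suc 2∤P) , ∣-refl))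
    λ ()
    where
    M≡5^ : suc P ≡ 5 ^ suc (2 * j)
    M≡5^ = trans M≡ (trans (*-identityˡ _) (cong (5 *_) (^-*-assoc 5 2 j)))
  even-odd (suc i) M≡ = inj₂ (inj₂ (i , j , trans M≡ (shift (4 ^ i) (25 ^ j))))
    where
    shift : ∀ s t → 4 * s * (5 * t) ≡ t * (s * 20)
    shift = solve-∀

-- Upper bounds for σ*(n)/n

-- For an atom `P` of `n`, `suc P` equals `σ* P` and divides `σ* n`, so it is itself of the form
-- 2ˣ5ʸ and falls into `Target`.
13σ*≤15n : ∀ {n} a b → .{{NonZero n}} → 2 ∤ n → 3 ∤ n → 7 ∤ n → σ* n ∣ 2 ^ a * 5 ^ b →
           13 * σ* n ≤ 15 * n
13σ*≤15n {n} a b 2∤n 3∤n 7∤n σ*n∣ = strip⇒σ*≤ n (strip-Target n) atoms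
  where
  atoms : Atoms⊆ Target n
  atoms {P} (P∥n , 1<P , σ*P) with smooth a b (∣-trans sucP∣σ*n σ*n∣)
    where
    sucP∣σ*n : suc P ∣ σ* n
    sucP∣σ*n = subst₂ _∣_ σ*P (sym (∥⇒σ*-* P∥n)) (m∣m*n _)
  ... | x , y , M≡ = smooth⇒Target x y M≡
    (λ 2∣P → 2∤n (∣-trans 2∣P P∣n)) (λ 3∣P → 3∤n (∣-trans 3∣P P∣n))
    (≢-sym (<⇒≢ 1<P)) (λ { refl → 7∤n P∣n })
    where
    P∣n = ∥⇒∣ P∥n

σ*-p-part : ∀ {p} n → .{{NonZero n}} → Prime p →
            ∃₂ λ e m → n ≡ p ^ e * m × p ∤ m × σ* n ≡ σ* (p ^ e) * σ* m
σ*-p-part n p-prime with p-part p-prime n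
... | e , m , refl , p∤m = e , m , refl , p∤m , σ*-* (coprime-^ˡ e (∤⇒coprime p-prime p∤m))

-- The quotient (n + 1) / n decreases as `n` grows.
suc-ratio : ∀ {c n} → c ≤ n → c * suc n ≤ suc c * n
suc-ratio {c} {n} c≤n = ≤-trans (≤-reflexive (*-suc c n)) (+-monoˡ-≤ (c * n) c≤n)

-- The lower bound k / l for s / n would exceed the upper bound q / p.
ratio-contradiction : ∀ k l p q {s n} → .{{NonZero n}} →
  k * n ≤ l * s → p * s ≤ q * n → ¬ l * q < k * p
ratio-contradiction k l p q {s} {n} kn≤ls ps≤qn lq<kp = <-irrefl refl (begin-strict
  l * q * n   <⟨ *-monoˡ-< n lq<kp ⟩
  k * p * n   ≡⟨ swap k p n ⟩
  k * n * p   ≤⟨ *-monoˡ-≤ p kn≤ls ⟩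
  l * s * p   ≡⟨ rotate l s p ⟩
  l * (p * s) ≤⟨ *-monoʳ-≤ l ps≤qn ⟩
  l * (q * n) ≡⟨ *-assoc l q n ⟨
  l * q * n   ∎)
  where
  open ≤-Reasoning
  swap : ∀ x y z → x * y * z ≡ x * z * y
  swap = solve-∀
  rotate : ∀ x y z → x * y * z ≡ x * (z * y)
  rotate = solve-∀

σ*-prime^-ratio : ∀ {p} c e → Prime p → c ≤ p ^ e → c * σ* (p ^ e) ≤ suc c * p ^ e
σ*-prime^-ratio c zero p-prime c≤1 = *-monoˡ-≤ 1 (n≤1+n c)
σ*-prime^-ratio {p} c (suc e) p-prime c≤pᵉ =
  subst (λ s → c * s ≤ suc c * p ^ suc e) (sym (σ*-prime^ e p-prime)) (suc-ratio c≤pᵉ)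

σ*-prime^-ratio₁ : ∀ {p} e → Prime p → p * σ* (p ^ e) ≤ suc p * p ^ e
σ*-prime^-ratio₁ {p} zero p-prime = *-monoˡ-≤ 1 (n≤1+n p)
σ*-prime^-ratio₁ {p} (suc e) p-prime =
  σ*-prime^-ratio p (suc e) p-prime (m≤m*n p (p ^ e) {{m^n≢0 p e {{prime⇒nonZero p-prime}}}})

-- The part at 7 adds a factor of at most 8/7, and 120/91 = 8/7 · 15/13.
91σ*≤120n : ∀ {n} a b → .{{NonZero n}} → 2 ∤ n → 3 ∤ n → σ* n ∣ 2 ^ a * 5 ^ b →
            91 * σ* n ≤ 120 * n
91σ*≤120n {n} a b 2∤n 3∤n σ*n∣ with σ*-p-part n prime₇
... | f , r , refl , 7∤r , σ*n≡ = subst (λ s → 91 * s ≤ 120 * n) (sym σ*n≡)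
  (*-ratio 7 8 13 15 (σ* (7 ^ f)) (7 ^ f) (σ* r) r (σ*-prime^-ratio₁ f prime₇)
    (13σ*≤15n a b {{m*n≢0⇒n≢0 (7 ^ f)}} (2∤n ∘ ∣n⇒∣m*n (7 ^ f)) (3∤n ∘ ∣n⇒∣m*n (7 ^ f)) 7∤r
      (∣-trans (divides (σ* (7 ^ f)) σ*n≡) σ*n∣)))

-- The part at 3 adds a factor of at most 4/3, and 480/273 = 4/3 · 120/91.
273σ*≤480n : ∀ {n} a b → .{{NonZero n}} → 2 ∤ n → σ* n ∣ 2 ^ a * 5 ^ b → 273 * σ* n ≤ 480 * n
273σ*≤480n {n} a b 2∤n σ*n∣ with σ*-p-part n prime₃
... | e , m , refl , 3∤m , σ*n≡ = subst (λ s → 273 * s ≤ 480 * n) (sym σ*n≡)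
  (*-ratio 3 4 91 120 (σ* (3 ^ e)) (3 ^ e) (σ* m) m (σ*-prime^-ratio₁ e prime₃)
    (91σ*≤120n a b {{m*n≢0⇒n≢0 (3 ^ e)}} (2∤n ∘ ∣n⇒∣m*n (3 ^ e)) 3∤m
      (∣-trans (divides (σ* (3 ^ e)) σ*n≡) σ*n∣)))

-- Now the part at 3 is at least 9 and adds at most 10/9, and 1200/819 = 10/9 · 120/91.
9∣⇒819σ*≤1200n : ∀ {n} a b → .{{NonZero n}} → 2 ∤ n → 9 ∣ n → σ* n ∣ 2 ^ a * 5 ^ b →
                 819 * σ* n ≤ 1200 * n
9∣⇒819σ*≤1200n {n} a b 2∤n 9∣n σ*n∣ with σ*-p-part n prime₃
... | e , m , refl , 3∤m , σ*n≡ = subst (λ s → 819 * s ≤ 1200 * n) (sym σ*n≡)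
  (*-ratio 9 10 91 120 (σ* (3 ^ e)) (3 ^ e) (σ* m) m (σ*-prime^-ratio 9 e prime₃ (9≤3^ e 9∣n))
    (91σ*≤120n a b {{m*n≢0⇒n≢0 (3 ^ e)}} (2∤n ∘ ∣n⇒∣m*n (3 ^ e)) 3∤m
      (∣-trans (divides (σ* (3 ^ e)) σ*n≡) σ*n∣)))
  where
  9≤3^ : ∀ e → 9 ∣ 3 ^ e * m → 9 ≤ 3 ^ e
  9≤3^ 0 9∣m = contradiction (∣-trans (divides 3 refl) (subst (9 ∣_) (*-identityˡ m) 9∣m)) 3∤m
  9≤3^ 1 9∣3m = contradiction (*-cancelˡ-∣ 3 9∣3m) 3∤m
  9≤3^ (suc (suc e)) _ = ≤-trans (m≤m*n 9 (3 ^ e) {{m^n≢0 3 e}}) (≤-reflexive (*-assoc 3 3 (3 ^ e)))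

-- Only the part at 3 is added: 60/39 = 4/3 · 15/13.
7∤⇒39σ*≤60n : ∀ {n} a b → .{{NonZero n}} → 2 ∤ n → 7 ∤ n → σ* n ∣ 2 ^ a * 5 ^ b →
              39 * σ* n ≤ 60 * n
7∤⇒39σ*≤60n {n} a b 2∤n 7∤n σ*n∣ with σ*-p-part n prime₃
... | e , m , refl , 3∤m , σ*n≡ = subst (λ s → 39 * s ≤ 60 * n) (sym σ*n≡)
  (*-ratio 3 4 13 15 (σ* (3 ^ e)) (3 ^ e) (σ* m) m (σ*-prime^-ratio₁ e prime₃)
    (13σ*≤15n a b {{m*n≢0⇒n≢0 (3 ^ e)}} (2∤n ∘ ∣n⇒∣m*n (3 ^ e)) 3∤m (7∤n ∘ ∣n⇒∣m*n (3 ^ e))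
      (∣-trans (divides (σ* (3 ^ e)) σ*n≡) σ*n∣)))

-- The value σ*(2ᵃ5ᵇ), divisibility, and the exponents a = 1 and a = 2

σ*-2^*5^ : ∀ a b → σ* (2 ^ suc a * 5 ^ suc b) ≡ suc (2 ^ suc a) * suc (5 ^ suc b)
σ*-2^*5^ a b = trans
  (σ*-* {2 ^ suc a} {5 ^ suc b} {{m*n≢0 _ _ {{m^n≢0 2 (suc a)}} {{m^n≢0 5 (suc b)}}}}
    (coprime-^ˡ (suc a) (Coprimality.sym (coprime-^ˡ (suc b) (gcd≡1⇒coprime {5} {2} refl)))))
  (cong₂ _*_ (σ*-prime^ a prime₂) (σ*-prime^ b prime₅))

-- An atom `P` of `n` is odd, and the even number `suc P` divides `σ* n`.
2∣σ* : ∀ {n} → 2 ∤ n → 1 < n → 2 ∣ σ* n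
2∣σ* {n} 2∤n 1<n with ∃-atom n 1<n
... | P , P∥n , 1<P , σ*P =
  ∣-trans (2∤⇒2∣suc (λ 2∣P → 2∤n (∣-trans 2∣P (∥⇒∣ P∥n))))
    (subst₂ _∣_ σ*P (sym (∥⇒σ*-* {{>-nonZero (<-trans z<s 1<n)}} P∥n)) (m∣m*n _))

odd-cancel : ∀ {m n} k → Coprime m 2 → m * k ≡ 2 * n → m ∣ n
odd-cancel k m⊥2 mk≡2n = coprime-divisor m⊥2 (divides k (trans (sym mk≡2n) (*-comm _ k)))

-- Modulo 7 the powers of 4 run through 1, 4, 2 and never reach -1; the period is 3 since 64 = 7 · 9
-- + 1.
7∤1+4^ : ∀ i → 7 ∤ suc (4 ^ i)
7∤1+4^ 0 = from-no (7 ∣? 2)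
7∤1+4^ 1 = from-no (7 ∣? 5)
7∤1+4^ 2 = from-no (7 ∣? 17)
7∤1+4^ (suc (suc (suc i))) 7∣ = 7∤1+4^ i
  (∣m+n∣m⇒∣n (subst (7 ∣_) (shift (4 ^ i)) 7∣) (m∣m*n (9 * 4 ^ i)))
  where
  shift : ∀ x → suc (4 * (4 * (4 * x))) ≡ 7 * (9 * x) + suc x
  shift = solve-∀

-- The second equation gives 3 ∣ n. A cofactor `m > 1` of the part at 3 would make both factors of
-- `σ* n` even, yet 4 does not divide 2 · 5ᵇ. So `n` is a power t of 3, and t + 1 = 2B with 3(B + 1)
-- = 2t forces B = 5.
σ*≡2*5^⇒≡9 : ∀ {n} b → .{{NonZero n}} → 2 ∤ n → σ* n ≡ 2 * 5 ^ b → 3 * suc (5 ^ b) ≡ 2 * n → n ≡ 9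
σ*≡2*5^⇒≡9 {n} b 2∤n σ*n≡ 2n≡ with σ*-p-part n prime₃
... | zero , m , refl , 3∤m , _ = contradiction
  (subst (3 ∣_) (*-identityˡ m) (odd-cancel (suc (5 ^ b)) (gcd≡1⇒coprime {3} {2} refl) 2n≡)) 3∤m
... | suc e , m , refl , 3∤m , σ*n≡* with 1 <? m
... | yes 1<m = contradiction
  (coprime-^ˡ b (gcd≡1⇒coprime {5} {2} refl) (2∣5ᵇ , ∣-refl)) λ ()
  where
  2∤3^ : 2 ∤ 3 ^ suc e
  2∤3^ 2∣3^ = contradiction (coprime-^ˡ (suc e) (gcd≡1⇒coprime {3} {2} refl) (2∣3^ , ∣-refl)) λ ()
  2∣5ᵇ : 2 ∣ 5 ^ b
  2∣5ᵇ = *-cancelˡ-∣ 2 (subst (4 ∣_) (trans (sym σ*n≡*) σ*n≡)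
    (*-pres-∣ (subst (2 ∣_) (sym (σ*-prime^ e prime₃)) (2∤⇒2∣suc 2∤3^))
      (2∣σ* (2∤n ∘ ∣n⇒∣m*n (3 ^ suc e)) 1<m)))
... | no 1≮m with ≤-antisym (≮⇒≥ 1≮m) (>-nonZero⁻¹ m {{m*n≢0⇒n≢0 (3 ^ suc e)}})
... | refl = trans (*-identityʳ t) (suc-injective (trans suc-t≡2B (cong (2 *_) B≡5)))
  where
  t = 3 ^ suc e
  B = 5 ^ b
  suc-t≡2B : suc t ≡ 2 * B
  suc-t≡2B = trans (sym (trans σ*n≡* (trans (*-identityʳ (σ* t)) (σ*-prime^ e prime₃)))) σ*n≡
  B≡5 : B ≡ 5
  B≡5 = +-cancelʳ-≡ (3 * B) B 5 (begin
    B + 3 * B       ≡⟨ double B ⟩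
    2 * (2 * B)     ≡⟨ cong (2 *_) suc-t≡2B ⟨
    2 * suc t       ≡⟨ *-suc 2 t ⟩
    2 + 2 * t       ≡⟨ cong (λ x → 2 + 2 * x) (*-identityʳ t) ⟨
    2 + 2 * (t * 1) ≡⟨ cong (2 +_) 2n≡ ⟨
    2 + 3 * suc B   ≡⟨ cong (2 +_) (*-suc 3 B) ⟩
    5 + 3 * B       ∎)
    where
    open ≡-Reasoning
    double : ∀ x → x + 3 * x ≡ 2 * (2 * x)
    double = solve-∀

-- The second equation gives 5 ∣ n. For the part t at 5, t + 1 is prime to 5 and divides 4 · 5ᵇ, so
-- it divides 4, although t ≥ 5.
σ*≢4*5^ : ∀ {n} b → .{{NonZero n}} → σ* n ≡ 4 * 5 ^ b → 5 * suc (5 ^ b) ≢ 2 * n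
σ*≢4*5^ {n} b σ*n≡ 2n≡ with σ*-p-part n prime₅
... | zero , m , refl , 5∤m , _ = contradiction
  (subst (5 ∣_) (*-identityˡ m) (odd-cancel (suc (5 ^ b)) (gcd≡1⇒coprime {5} {2} refl) 2n≡)) 5∤m
... | suc e , m , refl , 5∤m , σ*n≡* = contradiction (∣⇒≤ suc-t∣4)
  (<⇒≱ (s≤s (≤-trans (n≤1+n 4) (m≤m*n 5 (5 ^ e) {{m^n≢0 5 e}}))))
  where
  t = 5 ^ suc e
  5∤suc-t : 5 ∤ suc t
  5∤suc-t 5∣ = contradiction (∣1⇒≡1 (∣m+n∣m⇒∣n (subst (5 ∣_) (+-comm 1 t) 5∣) (m∣m*n (5 ^ e)))) λ ()
  suc-t∣4 : suc t ∣ 4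
  suc-t∣4 = coprime-divisor (Coprimality.sym (coprime-^ˡ b (∤⇒coprime prime₅ 5∤suc-t)))
    (subst₂ _∣_ (σ*-prime^ e prime₅) (trans (sym σ*n≡*) (trans σ*n≡ (*-comm 4 (5 ^ b)))) (m∣m*n (σ* m)))

-- Lower bounds for σ*(n)/n against the upper bounds

module _ {n a b} (n≢0 : NonZero n) (2∤n : 2 ∤ n)
         (σ*n≡ : σ* n ≡ 2 ^ a * 5 ^ b) (2n≡ : suc (2 ^ a) * suc (5 ^ b) ≡ 2 * n) where

  private
    instance
      _ : NonZero n
      _ = n≢0

    σ*n∣ : σ* n ∣ 2 ^ a * 5 ^ b
    σ*n∣ = ∣-reflexive σ*n≡

  -- 2n / σ*(n) is the product of (2ᵃ + 1) / 2ᵃ and (5ᵇ + 1) / 5ᵇ, and neither factor shrinks when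
  -- its denominator is lowered to `c` or `d`.
  n≤σ*-ratio : ∀ c d → c ≤ 2 ^ a → d ≤ 5 ^ b → c * d * 2 * n ≤ suc c * suc d * σ* n
  n≤σ*-ratio c d c≤ d≤ = subst₂ _≤_
    (trans (cong (c * d *_) 2n≡) (sym (*-assoc (c * d) 2 n)))
    (cong (suc c * suc d *_) (sym σ*n≡))
    (*-ratio c (suc c) d (suc d) (suc (2 ^ a)) (2 ^ a) (suc (5 ^ b)) (5 ^ b)
      (suc-ratio c≤) (suc-ratio d≤))

  a≥4∧b≥2⇒⊥ : 4 ≤ a → ¬ 2 ≤ b
  -- With 2⁴ = 16 and 5² = 25: 800/442 ≈ 1.81 exceeds 480/273 ≈ 1.76.
  a≥4∧b≥2⇒⊥ 4≤a 2≤b = ratio-contradiction (16 * 25 * 2) (17 * 26) 273 480 {σ* n}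
    (n≤σ*-ratio 16 25 (^-monoʳ-≤ 2 4≤a) (^-monoʳ-≤ 5 2≤b)) (273σ*≤480n a b 2∤n σ*n∣)
    (<ᵇ⇒< _ _ _)

  9∣n∧a≥3⇒⊥ : 9 ∣ n → 3 ≤ a → ¬ 1 ≤ b
  -- With 2³ = 8 and 5: 80/54 ≈ 1.48 exceeds 1200/819 ≈ 1.47.
  9∣n∧a≥3⇒⊥ 9∣n 3≤a 1≤b = ratio-contradiction (8 * 5 * 2) (9 * 6) 819 1200 {σ* n}
    (n≤σ*-ratio 8 5 (^-monoʳ-≤ 2 3≤a) (^-monoʳ-≤ 5 1≤b)) (9∣⇒819σ*≤1200n a b 2∤n 9∣n σ*n∣)
    (<ᵇ⇒< _ _ _)

  7∤n∧a≥4⇒⊥ : 7 ∤ n → 4 ≤ a → ¬ 1 ≤ b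
  -- With 2⁴ = 16 and 5: 160/102 ≈ 1.57 exceeds 60/39 ≈ 1.54.
  7∤n∧a≥4⇒⊥ 7∤n 4≤a 1≤b = ratio-contradiction (16 * 5 * 2) (17 * 6) 39 60 {σ* n}
    (n≤σ*-ratio 16 5 (^-monoʳ-≤ 2 4≤a) (^-monoʳ-≤ 5 1≤b)) (7∤⇒39σ*≤60n a b 2∤n 7∤n σ*n∣)
    (<ᵇ⇒< _ _ _)

-- Here n = 3(2ᵃ + 1). For odd a, 3 divides 2ᵃ + 1 and so 9 ∣ n; for a = 2i, 7 divides neither 3 nor
-- 4ⁱ + 1.
a≥4∧b≡1⇒⊥ : ∀ {n} a → NonZero n → 2 ∤ n → σ* n ≡ 2 ^ a * 5 ^ 1 → suc (2 ^ a) * 6 ≡ 2 * n → ¬ 4 ≤ a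
a≥4∧b≡1⇒⊥ {n} a n≢0 2∤n σ*n≡ 2n≡ 4≤a = by-parity (even-or-odd a)
  where
  n≡ : n ≡ suc (2 ^ a) * 3
  n≡ = *-cancelˡ-≡ n (suc (2 ^ a) * 3) 2 (trans (sym 2n≡) (shift (suc (2 ^ a))))
    where
    shift : ∀ x → x * 6 ≡ 2 * (x * 3)
    shift = solve-∀
  by-parity : ∃[ i ] (a ≡ 2 * i ⊎ a ≡ suc (2 * i)) → ⊥
  by-parity (i , inj₁ a≡2i) = 7∤n∧a≥4⇒⊥ {b = 1} n≢0 2∤n σ*n≡ 2n≡ 7∤n 4≤a ≤-refl
    where
    7∤n : 7 ∤ n
    7∤n 7∣n with euclidsLemma (suc (2 ^ a)) 3 prime₇ (subst (7 ∣_) n≡ 7∣n)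
    ... | inj₁ 7∣ = 7∤1+4^ i
      (subst (λ x → 7 ∣ suc x) (trans (cong (2 ^_) a≡2i) (sym (^-*-assoc 2 2 i))) 7∣)
    ... | inj₂ 7∣3 = contradiction 7∣3 (from-no (7 ∣? 3))
  by-parity (i , inj₂ refl) = 9∣n∧a≥3⇒⊥ {b = 1} n≢0 2∤n σ*n≡ 2n≡ 9∣n (≤-trans (n≤1+n 3) 4≤a) ≤-refl
    where
    9∣n : 9 ∣ n
    9∣n with ^≡1-mod3 1 i
    ... | u , eq = divides (suc (2 * u)) (trans n≡ (trans
      (cong (λ x → suc (2 * x) * 3) (trans (sym (^-*-assoc 2 2 i)) eq)) (expand u)))
      where
      expand : ∀ u → suc (2 * suc (3 * u)) * 3 ≡ suc (2 * u) * 9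
      expand = solve-∀

theorem5p3 : (N f₁ f₂ q : ℕ) → N > 0 → ¬ (2 ∣ N) → σ* (σ* N) ≡ 2 * N →
    N ≢ 9 → N ≢ 165 → Prime q → ¬ (2 ∣ q) → f₁ ≥ 1 → f₂ ≥ 1 →
    σ* N ≡ 2 ^ f₁ * q ^ f₂ → q ≢ 5
theorem5p3 N f₁@(suc a) f₂@(suc b) _ N>0 2∤N σ*σ*N≡2N N≢9 _ _ _ _ _ σ*N≡ refl = cases a b σ*N≡ 2N≡
  where
  N≢0 : NonZero N
  N≢0 = >-nonZero N>0
  2N≡ : suc (2 ^ f₁) * suc (5 ^ f₂) ≡ 2 * N
  2N≡ = trans (sym (trans (cong σ* σ*N≡) (σ*-2^*5^ a b))) σ*σ*N≡2N
  -- Both arguments are one less than the exponents of 2 and 5.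
  cases : ∀ a b → σ* N ≡ 2 ^ suc a * 5 ^ suc b → suc (2 ^ suc a) * suc (5 ^ suc b) ≡ 2 * N → ⊥
  cases 0 b σ*N≡ 2N≡ = N≢9 (σ*≡2*5^⇒≡9 (suc b) {{N≢0}} 2∤N σ*N≡ 2N≡)
  cases 1 b σ*N≡ 2N≡ = σ*≢4*5^ (suc b) {{N≢0}} σ*N≡ 2N≡
  -- 2³ + 1 = 9 is odd and divides 2N, hence 9 ∣ N.
  cases 2 b σ*N≡ 2N≡ = 9∣n∧a≥3⇒⊥ {a = 3} {suc b} N≢0 2∤N σ*N≡ 2N≡
    (odd-cancel (suc (5 ^ suc b)) (gcd≡1⇒coprime {9} {2} refl) 2N≡) ≤-refl (s≤s z≤n)
  cases (suc (suc (suc a))) 0 σ*N≡ 2N≡ =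
    a≥4∧b≡1⇒⊥ (4 + a) N≢0 2∤N σ*N≡ 2N≡ (m≤m+n 4 a)
  cases (suc (suc (suc a))) (suc b) σ*N≡ 2N≡ =
    a≥4∧b≥2⇒⊥ {a = 4 + a} {2 + b} N≢0 2∤N σ*N≡ 2N≡ (m≤m+n 4 a) (m≤m+n 2 b)
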